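{- Let $G$ be a nontrivial connected graph of order $n$ and maximum degree $\Delta(G)$. Then $$\max\{\Delta(G),\operatorname{diam}(G)\}\leq prc(G)\leq \chi'(G)+(n-1-\Delta(G)),$$ where the right-hand side equals $n$ if $G$ is class 2 and equals $n-1$ if $G$ is class 1.
   Context: All graphs are simple, finite and undirected. A path in an edge-coloured graph is a rainbow path if its edges receive pairwise distinct colours. An edge-colouring is proper if adjacent edges receive distinct colours. A connected graph $G$ with a proper edge-colouring is properly rainbow connected if every two distinct vertices are joined by a rainbow path. The proper rainbow connection number $prc(G)$ of a nontrivial connected graph $G$ is the minimum number of colours in a proper edge-colouring making $G$ properly rainbow connected. $\chi'(G)$ is the chromatic index; by Vizing's theorem $\chi'(G)\in\{\Delta(G),\Delta(G)+1\}$, and $G$ is class 1 if $\chi'(G)=\Delta(G)$ and class 2 otherwise. $\operatorname{diam}(G)$ is the diameter. -}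

module Defs where

open import Data.Bool.Base using (Bool; false; T)
open import Data.Bool.Properties using (T?; T-irrelevant)
open import Data.Empty using (⊥-elim)
open import Data.Fin.Base using (Fin; zero; suc; combine; finToFun; funToFin)
open import Data.Fin.Properties as Fin
  using (any?; all?; finToFun-funToFin; combine-injective; injective⇒≤)
open import Data.List.Base as List
  using (List; []; _∷_; allFin; filter; lookup; cartesianProductWith)
open import Data.List.Extrema.Nat using (max)
open import Data.List.Membership.Propositional.Properties using (∈-lookup)
open import Data.List.Relation.Unary.All as All using (All; []; _∷_)
open import Data.List.Relation.Unary.AllPairs using ([]; _∷_)
open import Data.List.Relation.Unary.Unique.Propositional using (Unique)
import Data.List.Relation.Unary.Unique.DecPropositional as DecUnique
open import Data.Nat.Base using (ℕ; zero; suc; _*_; _≤_; _<_)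
open import Data.Nat.Induction using (<-wellFounded)
open import Data.Nat.Properties as ℕ using (anyUpTo?)
open import Data.Product.Base using (Σ; ∃; _×_; _,_; proj₁; proj₂)
open import Data.Sum.Base using (_⊎_; inj₁; inj₂)
open import Function.Base using (_∘_)
open import Induction.WellFounded using (Acc; acc)
open import Relation.Binary.Construct.Closure.ReflexiveTransitive
  using (Star; ε; _◅_)
open import Relation.Binary.PropositionalEquality
  using (_≡_; _≢_; _≗_; refl; sym; trans; cong; cong₂; subst)
open import Relation.Nullary using (¬_; Dec; yes; no)
open import Relation.Nullary.Decidable using (map′; _×-dec_; _→-dec_; ¬?)
open import Relation.Unary using (Decidable)

------------------------------------------------------------------------
-- Minima of decidable inhabited predicates on ℕ

IsLeast : (ℕ → Set) → ℕ → Set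
IsLeast P m = P m × (∀ k → P k → m ≤ k)

least : {P : ℕ → Set} → Decidable P → ∃ P → ∃ (IsLeast P)
least {P} P? (N , pN) = go N pN (<-wellFounded N)
  where
  go : ∀ N → P N → Acc _<_ N → ∃ (IsLeast P)
  go N pN (acc rs) with anyUpTo? P? N
  ... | yes (k , k<N , pk) = go k pk (rs k<N)
  ... | no  none           = N , pN , λ k pk → ℕ.≮⇒≥ (λ k<N → none (k , k<N , pk))

------------------------------------------------------------------------
-- Graphs, paths and edge-colourings

record Graph (n : ℕ) : Set where
  field
    adj        : Fin n → Fin n → Bool
    adj-sym    : ∀ u v → adj u v ≡ adj v u
    adj-irrefl : ∀ u → adj u u ≡ false

module _ {n : ℕ} (G : Graph n) where
  open Graph G

  Adj : Fin n → Fin n → Set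
  Adj u v = T (adj u v)

  degree : Fin n → ℕ
  degree u = List.length (filter (λ v → T? (adj u v)) (allFin n))

  Δ : ℕ
  Δ = max 0 (List.map degree (allFin n))

  Walk : Fin n → Fin n → Set
  Walk = Star Adj

  vertices : ∀ {u v} → Walk u v → List (Fin n)
  vertices {u} ε       = u ∷ []
  vertices {u} (_ ◅ w) = u ∷ vertices w

  length : ∀ {u v} → Walk u v → ℕ
  length ε       = 0
  length (_ ◅ w) = suc (length w)

  IsPath : ∀ {u v} → Walk u v → Set
  IsPath w = Unique (vertices w)

  Connected : Set
  Connected = ∀ u v → ∃ λ (w : Walk u v) → IsPath w

  PathOfLength : Fin n → Fin n → ℕ → Set
  PathOfLength u v ℓ = ∃ λ (w : Walk u v) → length w ≡ ℓ × IsPath w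

  -- An undirected edge is represented by both of its orientations;
  -- colour-sym makes the colour a function of the undirected edge.
  record EdgeColouring (k : ℕ) : Set where
    field
      colour     : ∀ u v → Adj u v → Fin k
      colour-sym : ∀ u v (e : Adj u v) (e′ : Adj v u) →
                   colour u v e ≡ colour v u e′

  open EdgeColouring

  -- By colour-sym it is enough to compare edges uv and uw oriented away
  -- from their common end.
  Proper : ∀ {k} → EdgeColouring k → Set
  Proper c = ∀ u v w (e : Adj u v) (e′ : Adj u w) → v ≢ w →
             colour c u v e ≢ colour c u w e′

  colours : ∀ {k} → EdgeColouring k → ∀ {u v} → Walk u v → List (Fin k)
  colours c ε                 = []
  colours c (_◅_ {u} {v} e w) = colour c u v e ∷ colours c w

  IsRainbowPath : ∀ {k} → EdgeColouring k → ∀ {u v} → Walk u v → Set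
  IsRainbowPath c w = IsPath w × Unique (colours c w)

  RainbowConnecting : ∀ {k} → EdgeColouring k → Set
  RainbowConnecting c =
    ∀ u v → u ≢ v → ∃ λ (w : Walk u v) → IsRainbowPath c w

  ProperlyColourable : ℕ → Set
  ProperlyColourable k = Σ (EdgeColouring k) Proper

  ProperlyRainbowConnectable : ℕ → Set
  ProperlyRainbowConnectable k =
    Σ (EdgeColouring k) λ c → Proper c × RainbowConnecting c

------------------------------------------------------------------------
-- Finite search

lookup-injective : ∀ {A : Set} {xs : List A} → Unique xs →
                   ∀ {i j} → lookup xs i ≡ lookup xs j → i ≡ j
lookup-injective (_ ∷ _)  {zero}  {zero}  _  = refl
lookup-injective (p ∷ _)  {zero}  {suc j} eq = ⊥-elim (All.lookup p (∈-lookup j) eq)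
lookup-injective (p ∷ _)  {suc i} {zero}  eq = ⊥-elim (All.lookup p (∈-lookup i) (sym eq))
lookup-injective (_ ∷ ps) {suc i} {suc j} eq = cong suc (lookup-injective ps eq)

unique-length : ∀ {n} {xs : List (Fin n)} → Unique xs → List.length xs ≤ n
unique-length uniq = injective⇒≤ (lookup-injective uniq)

anyFun? : ∀ {m n} {P : (Fin m → Fin n) → Set} →
          (∀ {f g} → f ≗ g → P f → P g) → Decidable P → Dec (∃ P)
anyFun? resp P? = map′
  (λ (i , p) → finToFun i , p)
  (λ (f , p) → funToFin f , resp (λ i → sym (finToFun-funToFin f i)) p)
  (any? (P? ∘ finToFun))

anyFun₂? : ∀ {l m n} {P : (Fin l → Fin m → Fin n) → Set} →
           (∀ {f g} → (∀ i → f i ≗ g i) → P f → P g) →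
           Decidable P → Dec (∃ P)
anyFun₂? resp P? = map′
  (λ (g , p) → (λ i → finToFun (g i)) , p)
  (λ (f , p) → (λ i → funToFin (f i)) ,
               resp (λ i j → sym (finToFun-funToFin (f i) j)) p)
  (anyFun? (λ f≗g → resp (λ i j → cong (λ x → finToFun x j) (f≗g i)))
           (λ g → P? (λ i → finToFun (g i))))

-- The code of the unordered pair {u , v}.
pair : ∀ {n} → Fin n → Fin n → Fin (n * n)
pair u v with u Fin.≤? v
... | yes _ = combine u v
... | no  _ = combine v u

pair-sym : ∀ {n} (u v : Fin n) → pair u v ≡ pair v u
pair-sym u v with u Fin.≤? v | v Fin.≤? u
... | yes p | yes q = cong₂ combine (Fin.≤-antisym p q) (Fin.≤-antisym q p)
... | yes _ | no  _ = refl
... | no  _ | yes _ = refl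
... | no  p | no  q = ⊥-elim (p (ℕ.<⇒≤ (ℕ.≰⇒> q)))

pair-injective : ∀ {n} (u v x y : Fin n) → pair u v ≡ pair x y →
                 (u ≡ x × v ≡ y) ⊎ (u ≡ y × v ≡ x)
pair-injective u v x y eq with u Fin.≤? v | x Fin.≤? y
... | yes _ | yes _ = inj₁ (combine-injective u v x y eq)
... | yes _ | no  _ = inj₂ (combine-injective u v y x eq)
... | no  _ | yes _ with combine-injective v u x y eq
...   | p , q = inj₂ (q , p)
pair-injective u v x y eq | no _ | no _ with combine-injective v u y x eq
...   | p , q = inj₁ (q , p)

module _ {n : ℕ} (G : Graph n) where
  open Graph G
  open EdgeColouring

  walkOfLength? : ∀ ℓ u v {Q : Walk G u v → Set} → Decidable Q →
                  Dec (∃ λ w → length G w ≡ ℓ × Q w)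
  walkOfLength? zero u v Q? with u Fin.≟ v
  ... | no u≢v = no λ { (ε , _) → u≢v refl ; (_ ◅ _ , () , _) }
  ... | yes refl = map′ (λ q → ε , refl , q)
                        (λ { (ε , _ , q) → q ; (_ ◅ _ , () , _) }) (Q? ε)
  walkOfLength? (suc ℓ) u v {Q} Q? = map′
    (λ { (x , e , w , eq , q) → e ◅ w , cong suc eq , q })
    (λ { (ε , () , _) ; (e ◅ w , eq , q) → _ , e , w , ℕ.suc-injective eq , q })
    (any? step)
    where
    step : ∀ x → Dec (Σ (Adj G u x) λ e → ∃ λ w → length G w ≡ ℓ × Q (e ◅ w))
    step x with T? (adj u x)
    ... | no ¬e = no (¬e ∘ proj₁)
    ... | yes e = map′ (e ,_)
      (λ (e′ , w , eq , q) → w , eq , subst (λ e → Q (e ◅ w)) (T-irrelevant e′ e) q)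
      (walkOfLength? ℓ x v (Q? ∘ (e ◅_)))

  isPath? : ∀ {u v} → Decidable (IsPath G {u} {v})
  isPath? w = DecUnique.unique? Fin._≟_ (vertices G w)

  pathOfLength? : ∀ u v → Decidable (PathOfLength G u v)
  pathOfLength? u v ℓ = walkOfLength? ℓ u v isPath?

  length-vertices : ∀ {u v} (w : Walk G u v) →
                    List.length (vertices G w) ≡ suc (length G w)
  length-vertices ε       = refl
  length-vertices (_ ◅ w) = cong suc (length-vertices w)

  path-length : ∀ {u v} (w : Walk G u v) → IsPath G w → length G w < n
  path-length w p = subst (_≤ n) (length-vertices w) (unique-length p)

  rainbowPath? : ∀ {k} (c : EdgeColouring G k) u v →
                 Dec (∃ λ (w : Walk G u v) → IsRainbowPath G c w)
  rainbowPath? c u v = map′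
    (λ (_ , _ , w , _ , q) → w , q)
    (λ (w , q) → length G w , path-length w (proj₁ q) , w , refl , q)
    (anyUpTo? (λ ℓ → walkOfLength? ℓ u v
                (λ w → isPath? w ×-dec DecUnique.unique? Fin._≟_ (colours G c w))) n)

  all-edges? : ∀ {u v} {P : Adj G u v → Set} → Decidable P → Dec (∀ e → P e)
  all-edges? {u} {v} {P} P? with T? (adj u v)
  ... | no ¬e = yes (λ e → ⊥-elim (¬e e))
  ... | yes e = map′ (λ p e′ → subst P (T-irrelevant e e′) p) (λ f → f e) (P? e)

  proper? : ∀ {k} → Decidable (Proper G {k})
  proper? c = all? λ u → all? λ v → all? λ w →
    all-edges? λ e → all-edges? λ e′ →
    ¬? (v Fin.≟ w) →-dec ¬? (colour c u v e Fin.≟ colour c u w e′)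

  rainbowConnecting? : ∀ {k} → Decidable (RainbowConnecting G {k})
  rainbowConnecting? c = all? λ u → all? λ v →
    ¬? (u Fin.≟ v) →-dec rainbowPath? c u v

  SameColours : ∀ {k} → EdgeColouring G k → EdgeColouring G k → Set
  SameColours c d = ∀ u v e → colour c u v e ≡ colour d u v e

  proper-resp : ∀ {k} {c d : EdgeColouring G k} → SameColours c d →
                Proper G c → Proper G d
  proper-resp c≈d p u v w e e′ v≢w eq =
    p u v w e e′ v≢w (trans (c≈d u v e) (trans eq (sym (c≈d u w e′))))

  colours-resp : ∀ {k} {c d : EdgeColouring G k} → SameColours c d →
                 ∀ {u v} (w : Walk G u v) → colours G c w ≡ colours G d w
  colours-resp c≈d ε       = refl
  colours-resp c≈d (e ◅ w) = cong₂ _∷_ (c≈d _ _ e) (colours-resp c≈d w)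

  rainbowConnecting-resp : ∀ {k} {c d : EdgeColouring G k} → SameColours c d →
                           RainbowConnecting G c → RainbowConnecting G d
  rainbowConnecting-resp c≈d r u v u≢v with r u v u≢v
  ... | w , p , q = w , p , subst Unique (colours-resp c≈d w) q

  anyColouring? : ∀ {k} {P : EdgeColouring G k → Set} →
                  (∀ {c d} → SameColours c d → P c → P d) →
                  Decidable P → Dec (∃ P)
  anyColouring? {zero} resp P? with any? (λ u → any? (λ v → T? (adj u v)))
  ... | yes (u , v , e) = no λ (c , _) → Fin.¬Fin0 (colour c u v e)
  ... | no ¬edge = map′ (c₀ ,_)
                        (λ (c , p) → resp (λ u v e → ⊥-elim (¬edge (u , v , e))) p)
                        (P? c₀)
    where
    c₀ : EdgeColouring G zero
    c₀ = record
      { colour     = λ u v e → ⊥-elim (¬edge (u , v , e))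
      ; colour-sym = λ u v e → ⊥-elim (¬edge (u , v , e))
      }
  anyColouring? {suc k} {P} resp P? = map′
    (λ (f , s , p) → restrict f s , p)
    (λ (c , p) → extend c , extend-sym c , resp (restrict-extend c) p)
    (anyFun₂? Q-resp Q?)
    where
    Table : Set
    Table = Fin n → Fin n → Fin (suc k)

    SymOnEdges : Table → Set
    SymOnEdges f = ∀ u v → Adj G u v → f u v ≡ f v u

    restrict : ∀ f → SymOnEdges f → EdgeColouring G (suc k)
    restrict f s = record
      { colour     = λ u v _ → f u v
      ; colour-sym = λ u v e _ → s u v e
      }

    Q : Table → Set
    Q f = Σ (SymOnEdges f) λ s → P (restrict f s)

    Q-resp : ∀ {f g} → (∀ u → f u ≗ g u) → Q f → Q g
    Q-resp f≗g (s , p) =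
      (λ u v e → trans (sym (f≗g u v)) (trans (s u v e) (f≗g v u))) ,
      resp (λ u v _ → f≗g u v) p

    Q? : Decidable Q
    Q? f with all? (λ u → all? (λ v → T? (adj u v) →-dec (f u v Fin.≟ f v u)))
    ... | no ¬s = no (¬s ∘ proj₁)
    ... | yes s = map′ (s ,_) (λ (_ , p) → resp (λ _ _ _ → refl) p) (P? (restrict f s))

    extend : EdgeColouring G (suc k) → Table
    extend c u v with T? (adj u v)
    ... | yes e = colour c u v e
    ... | no  _ = zero

    restrict-extend : ∀ c u v e → colour c u v e ≡ extend c u v
    restrict-extend c u v e with T? (adj u v)
    ... | yes e′ = cong (colour c u v) (T-irrelevant e e′)
    ... | no ¬e  = ⊥-elim (¬e e)

    extend-sym : ∀ c → SymOnEdges (extend c)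
    extend-sym c u v e = trans (sym (restrict-extend c u v e))
      (trans (colour-sym c u v e e′) (restrict-extend c v u e′))
      where e′ = subst T (adj-sym u v) e

  properlyColourable? : Decidable (ProperlyColourable G)
  properlyColourable? k =
    anyColouring? (λ {c} {d} → proper-resp {c = c} {d}) proper?

  properlyRainbowConnectable? : Decidable (ProperlyRainbowConnectable G)
  properlyRainbowConnectable? k = anyColouring?
    (λ {c} {d} c≈d (p , r) → proper-resp {c = c} {d} c≈d p ,
                             rainbowConnecting-resp {c = c} {d} c≈d r)
    (λ c → proper? c ×-dec rainbowConnecting? c)

  -- All edges get different colours.
  distinctColouring : EdgeColouring G (n * n)
  distinctColouring = record
    { colour     = λ u v _ → pair u v
    ; colour-sym = λ u v _ _ → pair-sym u v
    }

  distinct-proper : Proper G distinctColouring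
  distinct-proper u v w e e′ v≢w eq with pair-injective u v u w eq
  ... | inj₁ (_ , v≡w)   = v≢w v≡w
  ... | inj₂ (u≡w , v≡u) = v≢w (trans v≡u u≡w)

  distinct-fresh : ∀ {u v x y} (w : Walk G x y) → All (u ≢_) (vertices G w) →
                   All (pair u v ≢_) (colours G distinctColouring w)
  distinct-fresh ε _ = []
  distinct-fresh {u} {v} (_◅_ {x} {z} e w) (u≢x ∷ u∉w) =
    fresh ∷ distinct-fresh w u∉w
    where
    head : ∀ {z y} (w : Walk G z y) → All (u ≢_) (vertices G w) → u ≢ z
    head ε       (p ∷ _) = p
    head (_ ◅ _) (p ∷ _) = p
    fresh : pair u v ≢ pair x z
    fresh eq with pair-injective u v x z eq
    ... | inj₁ (u≡x , _) = u≢x u≡x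
    ... | inj₂ (u≡z , _) = head w u∉w u≡z

  distinct-rainbow : ∀ {u v} (w : Walk G u v) → IsPath G w →
                     Unique (colours G distinctColouring w)
  distinct-rainbow ε       _          = []
  distinct-rainbow (e ◅ w) (u∉w ∷ ps) =
    distinct-fresh w u∉w ∷ distinct-rainbow w ps

------------------------------------------------------------------------
-- The invariants

  χ′-least : ∃ (IsLeast (ProperlyColourable G))
  χ′-least = least properlyColourable? (n * n , distinctColouring , distinct-proper)

  χ′ : ℕ
  χ′ = proj₁ χ′-least

  Class1 : Set
  Class1 = χ′ ≡ Δ G

  Class2 : Set
  Class2 = ¬ Class1

  module _ (conn : Connected G) where

    dist-least : ∀ u v → ∃ (IsLeast (PathOfLength G u v))
    dist-least u v = least (pathOfLength? u v)
      (length G (proj₁ (conn u v)) , proj₁ (conn u v) , refl , proj₂ (conn u v))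

    dist : Fin n → Fin n → ℕ
    dist u v = proj₁ (dist-least u v)

    diam : ℕ
    diam = max 0 (cartesianProductWith dist (allFin n) (allFin n))

    prc-least : ∃ (IsLeast (ProperlyRainbowConnectable G))
    prc-least = least properlyRainbowConnectable?
      (n * n , distinctColouring , distinct-proper , λ u v _ →
        let (w , p) = conn u v in w , p , distinct-rainbow w p)

    prc : ℕ
    prc = proj₁ prc-least

{-# OPTIONS --safe #-}

-- Lower bound: the colours at a vertex are distinct, and a rainbow path uses at
-- least as many colours as the distance of its ends.
--
-- Upper bound: take a proper colouring with χ′ colours and a spanning tree
-- containing the star at a vertex r of maximum degree, and recolour the
-- n − 1 − Δ tree edges outside the star with new, pairwise distinct colours.
-- The colouring stays proper and becomes injective on the tree, so the paths of
-- the tree are rainbow.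
--
-- The values in the class 1 and class 2 cases rest on Vizing's theorem, proved
-- with Misra–Gries fans.  A proper partial colouring is treated as a family of
-- involutions, one for each colour, and the Kempe chain of x is the orbit of x
-- under two of them.
module Submission where

open import Defs
open import Data.Bool.Base using (Bool; true; false; not; if_then_else_; T)
open import Data.Bool.Properties using (T?)
open import Data.Empty using (⊥; ⊥-elim)
open import Data.Fin.Base using (Fin; zero; suc; toℕ; join; splitAt)
open import Data.Fin.Permutation.Components using (transpose)
open import Data.Fin.Properties as Fin using (any?; pigeonhole)
open import Data.List.Base as List using (List; []; _∷_; _++_; allFin; filter; cartesianProduct)
open import Data.List.Extrema.Nat using (xs≤max; max≤v⁺; max<v⁺)
open import Data.List.Membership.Propositional using (_∈_)
open import Data.List.Membership.Propositional.Properties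
  using (∈-∃++; ∈-allFin; ∈-cartesianProduct⁺; ∈-cartesianProductWith⁻; ∈-filter⁺; ∈-filter⁻;
         ∈-lookup; ∈-map⁺)
import Data.List.Properties as List
open import Data.List.Relation.Unary.All as All using (All; []; _∷_)
open import Data.List.Relation.Unary.All.Properties as All using (¬Any⇒All¬)
open import Data.List.Relation.Unary.AllPairs using ([]; _∷_)
open import Data.List.Relation.Unary.Any as Any using (here; there; index)
open import Data.List.Relation.Unary.Any.Properties using (lookup-index)
open import Data.List.Relation.Unary.Unique.Propositional using (Unique)
import Data.List.Relation.Unary.Unique.Propositional.Properties as Unique
open import Data.Nat.Base using (ℕ; zero; suc; pred; _+_; _∸_; _⊔_; _≤_; _<_; z≤n; s≤s; s≤s⁻¹)
open import Data.Nat.Induction using (<-wellFounded)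
open import Data.Nat.Properties as ℕ using (anyUpTo?)
open import Data.Product.Base using (∃; _×_; _,_; proj₁; proj₂)
open import Data.Sum.Base using (_⊎_; inj₁; inj₂; [_,_]′)
open import Data.Unit.Base using (⊤; tt)
open import Function.Base using (_∘_)
open import Induction.WellFounded using (Acc; acc)
open import Relation.Binary.Construct.Closure.ReflexiveTransitive
  using (Star; ε; _◅_; _◅◅_; reverse)
open import Relation.Binary.PropositionalEquality
  using (_≡_; _≢_; refl; sym; trans; cong; subst)
open import Relation.Nullary using (¬_; Dec; yes; no)
open import Relation.Nullary.Decidable using (decidable-stable; _×-dec_; ¬?)
open import Relation.Unary using (Decidable)

-- Duplicate-free lists and transpositions of colours

unique-++-≢ : ∀ {A : Set} (xs : List A) {ys y z} → Unique (xs ++ ys) → y ∈ xs → z ∈ ys → y ≢ z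
unique-++-≢ (_ ∷ xs) (fresh ∷ _) (here refl) z∈ = All.lookup (All.++⁻ʳ xs fresh) z∈
unique-++-≢ (_ ∷ xs) (_ ∷ uniq)  (there y∈)  z∈ = unique-++-≢ xs uniq y∈ z∈

unique-replace : ∀ {A : Set} (xs : List A) {ys y z} → All (z ≢_) (xs ++ y ∷ ys) →
                 Unique (xs ++ y ∷ ys) → Unique (xs ++ z ∷ ys)
unique-replace []       (_ ∷ z∉)   (_ ∷ uniq)     = z∉ ∷ uniq
unique-replace (x ∷ xs) (z≢x ∷ z∉) (fresh ∷ uniq) with All.++⁻ xs fresh
... | l , _ ∷ r = All.++⁺ l ((z≢x ∘ sym) ∷ r) ∷ unique-replace xs z∉ uniq

unique-prefix : ∀ {A : Set} (xs : List A) {ys} → Unique (xs ++ ys) → Unique xs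
unique-prefix []       _              = []
unique-prefix (_ ∷ xs) (fresh ∷ uniq) = All.++⁻ˡ xs fresh ∷ unique-prefix xs uniq

transpose-first : ∀ {k} (c d : Fin k) → transpose c d c ≡ d
transpose-first c d with c Fin.≟ c
... | yes _ = refl
... | no ¬p = ⊥-elim (¬p refl)

transpose-second : ∀ {k} (c d : Fin k) → transpose c d d ≡ c
transpose-second c d with d Fin.≟ c
... | yes d≡c = d≡c
... | no _ with d Fin.≟ d
...   | yes _ = refl
...   | no ¬p = ⊥-elim (¬p refl)

transpose-other : ∀ {k} (c d e : Fin k) → e ≢ c → e ≢ d → transpose c d e ≡ e
transpose-other c d e e≢c e≢d with e Fin.≟ c
... | yes e≡c = ⊥-elim (e≢c e≡c)
... | no _ with e Fin.≟ d
...   | yes e≡d = ⊥-elim (e≢d e≡d)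
...   | no _    = refl

-- An eliminator: `P` sees a colour together with its image, so that one case analysis settles both.
transpose-cases : ∀ {k} (c d e : Fin k) {P : Fin k → Fin k → Set} →
                  P c d → P d c → (e ≢ c → e ≢ d → P e e) → P e (transpose c d e)
transpose-cases c d e cd dc ee with e Fin.≟ c
... | yes refl = cd
... | no e≢c with e Fin.≟ d
...   | yes refl = dc
...   | no e≢d   = ee e≢c e≢d

transpose-involutive : ∀ {k} (c d e : Fin k) → transpose c d (transpose c d e) ≡ e
transpose-involutive c d e = transpose-cases c d e {λ e e′ → transpose c d e′ ≡ e}
  (transpose-second c d) (transpose-first c d) (transpose-other c d e)

-- Kempe chains

-- The two involutions are the edges of two colours. As `x` misses the colour `false`, its component
-- is a path with `x` at one end, and the walk leaves `x` by the colour `true`.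
module Alternating {n} (h : Bool → Fin n → Fin n)
                   (h-involutive : ∀ b u → h b (h b u) ≡ u)
                   (x : Fin n) (x-fixed : h false x ≡ x) where

  turn : ℕ → Bool
  turn zero    = true
  turn (suc i) = not (turn i)

  seq : ℕ → Fin n
  seq zero    = x
  seq (suc i) = h (turn i) (seq i)

  neighbour : ∀ b i → h b (seq i) ≡ seq (suc i) ⊎ h b (seq i) ≡ seq (pred i)
  neighbour true  zero    = inj₁ refl
  -- `pred zero` is `zero`, so `x` counts as its own predecessor.
  neighbour false zero    = inj₂ x-fixed
  neighbour b     (suc i) with turn i | b
  ... | true  | true  = inj₂ (h-involutive _ _)
  ... | true  | false = inj₁ refl
  ... | false | true  = inj₁ refl
  ... | false | false = inj₂ (h-involutive _ _)

  VisitedBy : ℕ → Fin n → Set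
  VisitedBy m u = ∃ λ i → i < suc m × seq i ≡ u

  visitedBy? : ∀ m → Decidable (VisitedBy m)
  visitedBy? m u = anyUpTo? (λ i → seq i Fin.≟ u) (suc m)

  -- Until the walk first returns to its past it visits the whole orbit; a fixed
  -- point other than x makes it return at once, so only the last vertex can be one.
  Returns : ℕ → Set
  Returns m = VisitedBy m (seq (suc m))

  firstReturn : ∃ (IsLeast Returns)
  firstReturn with pigeonhole (ℕ.n<1+n n) (λ i → seq (toℕ i))
  ... | i , Fin.suc j , i<j , eq =
    least (λ m → visitedBy? m (seq (suc m))) (toℕ j , toℕ i , i<j , eq)

  last : ℕ
  last = proj₁ firstReturn

  Orbit : Fin n → Set
  Orbit = VisitedBy last

  orbit? : Decidable Orbit
  orbit? = visitedBy? last

  start∈orbit : Orbit x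
  start∈orbit = 0 , s≤s z≤n , refl

  -- The two colours lead from a vertex of the walk to its predecessor and its successor; beyond the
  -- last vertex the walk has returned.
  orbit-closed : ∀ b {u} → Orbit u → Orbit (h b u)
  orbit-closed b (i , i≤l , refl) with neighbour b i
  ... | inj₂ eq = pred i , ℕ.≤-<-trans ℕ.pred[n]≤n i≤l , sym eq
  ... | inj₁ eq with ℕ.m≤n⇒m<n∨m≡n i≤l
  ...   | inj₁ i<l  = suc i , i<l , sym eq
  ...   | inj₂ refl = subst Orbit (sym eq) (proj₁ (proj₂ firstReturn))

  fixed⇒last : ∀ b {u} → Orbit u → h b u ≡ u → u ≢ x → u ≡ seq last
  fixed⇒last b (i , i≤l , refl) fixed u≢x with neighbour b i
  ... | inj₁ eq = cong seq (ℕ.≤-antisym (s≤s⁻¹ i≤l)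
          (proj₂ (proj₂ firstReturn) i (i , ℕ.n<1+n i , trans (sym fixed) eq)))
  fixed⇒last b (zero  , _ , refl) fixed u≢x | inj₂ _ = ⊥-elim (u≢x refl)
  -- A fixed point of the colour leading back equals its predecessor, which would be a return before
  -- `last`.
  fixed⇒last b (suc i , i≤l , refl) fixed u≢x | inj₂ eq = ⊥-elim (ℕ.<⇒≱ (s≤s⁻¹ i≤l)
          (proj₂ (proj₂ firstReturn) i (i , ℕ.n<1+n i , trans (sym eq) fixed)))

-- Vizing's theorem

module _ {n : ℕ} (G : Graph n) where
  open Graph G

  Adj-sym : ∀ {u v} → Adj G u v → Adj G v u
  Adj-sym {u} {v} = subst T (adj-sym u v)

  Adj-irrefl : ∀ {u v} → Adj G u v → u ≢ v
  Adj-irrefl e refl = subst T (adj-irrefl _) e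

  -- mate c u is the other end of the edge of colour c at u, and u itself if there
  -- is none.  Thus Coloured M u u is junk: it holds if some colour misses u.
  record PartialColouring (k : ℕ) : Set where
    field
      mate       : Fin k → Fin n → Fin n
      involutive : ∀ c u → mate c (mate c u) ≡ u
      adjacent   : ∀ c u → mate c u ≢ u → Adj G u (mate c u)
      disjoint   : ∀ {c d u} → c ≢ d → mate c u ≡ mate d u → mate c u ≡ u

  open PartialColouring

  Coloured : ∀ {k} → PartialColouring k → Fin n → Fin n → Set
  Coloured M u v = ∃ λ c → mate M c u ≡ v

  coloured-sym : ∀ {k} (M : PartialColouring k) {u v} → Coloured M u v → Coloured M v u
  coloured-sym M (c , refl) = c , involutive M c _

  empty : ∀ {k} → PartialColouring k
  empty = record
    { mate = λ _ u → u ; involutive = λ _ _ → refl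
    ; adjacent = λ _ _ u≢u → ⊥-elim (u≢u refl) ; disjoint = λ _ _ → refl }

  -- Exchanging two colours, and colouring one edge

  module _ {k} (M : PartialColouring k) where

    -- Closed under both colours, `S` is a union of components of the edges coloured `c` or `d`;
    -- exchanging the two colours inside `S` alone therefore stays proper.
    module Swap (c d : Fin k) {S : Fin n → Set} (S? : Decidable S)
                (c-closed : ∀ {u} → S u → S (mate M c u))
                (d-closed : ∀ {u} → S u → S (mate M d u)) where

      mate′ : Fin k → Fin n → Fin n
      mate′ e u with S? u
      ... | yes _ = mate M (transpose c d e) u
      ... | no  _ = mate M e u

      swap-inside : ∀ e {u} → S u → mate′ e u ≡ mate M (transpose c d e) u
      swap-inside e {u} s with S? u
      ... | yes _ = refl
      ... | no ¬s = ⊥-elim (¬s s)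

      swap-outside : ∀ e {u} → ¬ S u → mate′ e u ≡ mate M e u
      swap-outside e {u} ¬s with S? u
      ... | yes s = ⊥-elim (¬s s)
      ... | no _  = refl

      swap-other : ∀ {e} u → e ≢ c → e ≢ d → mate′ e u ≡ mate M e u
      swap-other {e} u e≢c e≢d with S? u
      ... | yes _ = cong (λ f → mate M f u) (transpose-other c d e e≢c e≢d)
      ... | no _  = refl

      -- Edges of the other colours may leave `S`, but the transposition fixes these colours, so
      -- both ends of such an edge still agree.
      closed : ∀ e {u} → S u → S (mate M (transpose c d e) u) ⊎ transpose c d e ≡ e
      closed e s = transpose-cases c d e {λ e e′ → S (mate M e′ _) ⊎ e′ ≡ e}
        (inj₁ (d-closed s)) (inj₁ (c-closed s)) (λ _ _ → inj₂ refl)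

      reflected : ∀ e {u} → S (mate M e u) → S u ⊎ transpose c d e ≡ e
      reflected e s = transpose-cases c d e {λ e e′ → S (mate M e _) → S _ ⊎ e′ ≡ e}
        (λ s → inj₁ (subst S (involutive M c _) (c-closed s)))
        (λ s → inj₁ (subst S (involutive M d _) (d-closed s)))
        (λ _ _ _ → inj₂ refl) s

      involutive′ : ∀ e u → mate′ e (mate′ e u) ≡ u
      involutive′ e u with S? u
      involutive′ e u | yes s with S? (mate M (transpose c d e) u)
      ... | yes _ = involutive M _ u
      ... | no ¬s′ with closed e s
      ...   | inj₁ s′ = ⊥-elim (¬s′ s′)
      ...   | inj₂ eq = trans (cong (λ f → mate M f (mate M (transpose c d e) u)) (sym eq))
                            (involutive M _ u)
      involutive′ e u | no ¬s with S? (mate M e u)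
      ... | no _   = involutive M e u
      ... | yes s′ with reflected e s′
      ...   | inj₁ s  = ⊥-elim (¬s s)
      ...   | inj₂ eq = trans (cong (λ f → mate M f (mate M e u)) eq) (involutive M e u)

      adjacent′ : ∀ e u → mate′ e u ≢ u → Adj G u (mate′ e u)
      adjacent′ e u with S? u
      ... | yes _ = adjacent M _ u
      ... | no  _ = adjacent M e u

      disjoint′ : ∀ {e f u} → e ≢ f → mate′ e u ≡ mate′ f u → mate′ e u ≡ u
      disjoint′ {e} {f} {u} e≢f with S? u
      ... | no  _ = disjoint M e≢f
      ... | yes _ = disjoint M λ eq → e≢f (trans (sym (transpose-involutive c d e))
                      (trans (cong (transpose c d) eq) (transpose-involutive c d f)))

      swap : PartialColouring k
      swap = record { mate = mate′ ; involutive = involutive′ ; adjacent = adjacent′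
                    ; disjoint = disjoint′ }

      swap-coloured : ∀ {u v} → Coloured M u v → Coloured swap u v
      swap-coloured {u} {v} (e , eq) = recoloured (S? u)
        where
        recoloured : Dec (S u) → Coloured swap u v
        recoloured (no ¬s) = e , trans (swap-outside e ¬s) eq
        recoloured (yes s) = transpose c d e , trans (swap-inside _ s)
          (trans (cong (λ f → mate M f u) (transpose-involutive c d e)) eq)

      swap-coloured⁻ : ∀ {u v} → Coloured swap u v → Coloured M u v
      swap-coloured⁻ {u} (e , eq) with S? u
      ... | yes _ = transpose c d e , eq
      ... | no _  = e , eq

    module Kempe (c d : Fin k) (x : Fin n) (fixed : mate M c x ≡ x) where

      open Alternating (λ b → mate M (if b then d else c)) (λ b → involutive M _) x fixed public
      open Swap c d orbit? (orbit-closed false) (orbit-closed true) public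

      -- A vertex of the chain other than `x` that misses `d` is the last one of the walk.
      one-end : ∀ {u v} → u ≢ x → v ≢ x → mate M d u ≡ u → mate M d v ≡ v →
                Orbit u → Orbit v → u ≡ v
      one-end u≢x v≢x du dv iu iv =
        trans (fixed⇒last true iu du u≢x) (sym (fixed⇒last true iv dv v≢x))

    -- Gives xv the colour β, which the edge xw loses (if β misses x then w ≡ x).
    module Put (x v : Fin n) (β : Fin k) (xv : Adj G x v)
               (uncoloured : ¬ Coloured M x v) (free : mate M β v ≡ v) where

      w : Fin n
      w = mate M β x

      w≢v : w ≢ v
      w≢v eq = uncoloured (β , eq)

      x≢v : x ≢ v
      x≢v = Adj-irrefl xv

      -- The new involution for `β`. The test for `x` precedes that for `w`, which matters when they
      -- coincide.
      move : Fin n → Fin n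
      move u with u Fin.≟ x
      ... | yes _ = v
      ... | no  _ with u Fin.≟ v
      ...   | yes _ = x
      ...   | no  _ with u Fin.≟ w
      ...     | yes _ = u
      ...     | no  _ = mate M β u

      move-x : move x ≡ v
      move-x with x Fin.≟ x
      ... | yes _ = refl
      ... | no ¬p = ⊥-elim (¬p refl)

      move-v : move v ≡ x
      move-v with v Fin.≟ x
      ... | yes v≡x = ⊥-elim (x≢v (sym v≡x))
      ... | no _ with v Fin.≟ v
      ...   | yes _ = refl
      ...   | no ¬p = ⊥-elim (¬p refl)

      move-w : w ≢ x → move w ≡ w
      move-w w≢x with w Fin.≟ x
      ... | yes w≡x = ⊥-elim (w≢x w≡x)
      ... | no _ with w Fin.≟ v
      ...   | yes w≡v = ⊥-elim (w≢v w≡v)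
      ...   | no _ with w Fin.≟ w
      ...     | yes _ = refl
      ...     | no ¬p = ⊥-elim (¬p refl)

      move-other : ∀ {u} → u ≢ x → u ≢ v → u ≢ w → move u ≡ mate M β u
      move-other {u} u≢x u≢v u≢w with u Fin.≟ x
      ... | yes p = ⊥-elim (u≢x p)
      ... | no _ with u Fin.≟ v
      ...   | yes p = ⊥-elim (u≢v p)
      ...   | no _ with u Fin.≟ w
      ...     | yes p = ⊥-elim (u≢w p)
      ...     | no _  = refl

      move-cases : {P : Fin n → Fin n → Set} → P x v → P v x → (w ≢ x → P w w) →
                   (∀ u → u ≢ x → u ≢ v → u ≢ w → P u (mate M β u)) → ∀ u → P u (move u)
      move-cases px pv pw po u with u Fin.≟ x
      ... | yes refl = px
      ... | no u≢x with u Fin.≟ v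
      ...   | yes refl = pv
      ...   | no u≢v with u Fin.≟ w
      ...     | yes refl = pw u≢x
      ...     | no u≢w   = po u u≢x u≢v u≢w

      move-involutive : ∀ u → move (move u) ≡ u
      move-involutive = move-cases {λ u u′ → move u′ ≡ u} move-v move-x move-w
        -- `mate M β` exchanges `x` with `w` and fixes `v`, so it maps the remaining vertices to
        -- each other.
        λ u u≢x u≢v u≢w → trans
          (move-other (λ eq → u≢w (trans (sym (involutive M β u)) (cong (mate M β) eq)))
                      (λ eq → u≢v (trans (sym (involutive M β u))
                                    (trans (cong (mate M β) eq) free)))
                      (λ eq → u≢x (trans (sym (involutive M β u))
                                    (trans (cong (mate M β) eq) (involutive M β x)))))
          (involutive M β u)

      move-adjacent : ∀ u → move u ≢ u → Adj G u (move u)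
      move-adjacent = move-cases {λ u u′ → u′ ≢ u → Adj G u u′}
        (λ _ → xv) (λ _ → Adj-sym xv) (λ _ w≢w → ⊥-elim (w≢w refl))
        (λ u _ _ _ → adjacent M β u)

      -- The only new pair is `x`, `v`, which no colour of `M` joins.
      move-disjoint : ∀ {e} → e ≢ β → ∀ u → move u ≡ mate M e u → move u ≡ u
      move-disjoint {e} e≢β = move-cases {λ u u′ → u′ ≡ mate M e u → u′ ≡ u}
        (λ eq → ⊥-elim (uncoloured (e , sym eq)))
        (λ eq → ⊥-elim (uncoloured (coloured-sym M (e , sym eq))))
        (λ _ _ → refl)
        (λ u _ _ _ → disjoint M (e≢β ∘ sym))

      mate′ : Fin k → Fin n → Fin n
      mate′ e with e Fin.≟ β
      ... | yes _ = move
      ... | no  _ = mate M e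

      put : PartialColouring k
      put = record { mate = mate′ ; involutive = involutive′ ; adjacent = adjacent′
                   ; disjoint = disjoint′ }
        where
        involutive′ : ∀ e u → mate′ e (mate′ e u) ≡ u
        involutive′ e with e Fin.≟ β
        ... | yes _ = move-involutive
        ... | no  _ = involutive M e
        adjacent′ : ∀ e u → mate′ e u ≢ u → Adj G u (mate′ e u)
        adjacent′ e with e Fin.≟ β
        ... | yes _ = move-adjacent
        ... | no  _ = adjacent M e
        disjoint′ : ∀ {e f u} → e ≢ f → mate′ e u ≡ mate′ f u → mate′ e u ≡ u
        disjoint′ {e} {f} {u} e≢f eq with e Fin.≟ β | f Fin.≟ β
        ... | yes refl | yes refl = ⊥-elim (e≢f refl)
        ... | yes refl | no _     = move-disjoint (e≢f ∘ sym) u eq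
        ... | no _     | yes refl = trans eq (move-disjoint e≢f u (sym eq))
        ... | no _     | no _     = disjoint M e≢f eq

      put-β : ∀ u → mate put β u ≡ move u
      put-β u with β Fin.≟ β
      ... | yes _ = refl
      ... | no ¬p = ⊥-elim (¬p refl)

      put-other : ∀ {e} u → e ≢ β → mate put e u ≡ mate M e u
      put-other {e} u e≢β with e Fin.≟ β
      ... | yes p = ⊥-elim (e≢β p)
      ... | no _  = refl

      put-colours : Coloured put x v
      put-colours = β , trans (put-β x) move-x

      -- By disjointness `β` was the only colour of this edge.
      put-uncolours : w ≢ x → ¬ Coloured put x w
      put-uncolours w≢x (e , eq) with e Fin.≟ β
      ... | yes refl = w≢v (trans (sym eq) move-x)
      ... | no e≢β   = w≢x (disjoint M (e≢β ∘ sym) (sym eq))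

      put-keeps : ∀ {a b} → a ≢ b → Coloured M a b →
                  Coloured put a b ⊎ (a ≡ x × b ≡ w) ⊎ (a ≡ w × b ≡ x)
      put-keeps {a} a≢b (e , refl) with e Fin.≟ β
      ... | no e≢β = inj₁ (e , put-other a e≢β)
      ... | yes refl with a Fin.≟ x | a Fin.≟ w | a Fin.≟ v
      ...   | yes refl | _        | _        = inj₂ (inj₁ (refl , refl))
      ...   | no _     | yes refl | _        = inj₂ (inj₂ (refl , involutive M β x))
      ...   | no _     | no _     | yes refl = ⊥-elim (a≢b (sym free))
      ...   | no a≢x   | no a≢w   | no a≢v   = inj₁ (β , trans (put-β a) (move-other a≢x a≢v a≢w))

  -- The condition `a ≢ b` leaves out the junk pairs, which can be lost when a missing colour
  -- becomes present.
  Extends : ∀ {k} → PartialColouring k → PartialColouring k → Set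
  Extends M M′ = ∀ {a b} → a ≢ b → Coloured M a b → Coloured M′ a b

  Extension : ∀ {k} → PartialColouring k → Fin n → Fin n → Set
  Extension M u v = ∃ λ M′ → Coloured M′ u v × Extends M M′

  extension-trans : ∀ {k} {M M′ : PartialColouring k} {u v} →
                    Extends M M′ → Extension M′ u v → Extension M u v
  extension-trans M⊆M′ (M″ , uv , M′⊆M″) = M″ , uv , λ a≢b → M′⊆M″ a≢b ∘ M⊆M′ a≢b

  -- Fans and their rotation

  module _ {k : ℕ} (x : Fin n) where

    infixr 5 _∷_

    -- A fan at x is given by colours β₁, β₂, …: its spokes end in v, mate β₁ x,
    -- mate β₂ x, …, and each colour is missing at the spoke before it.
    data Fan (M : PartialColouring k) : Fin n → List (Fin k) → Fin n → Set where
      []  : ∀ {v} → Fan M v [] v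
      _∷_ : ∀ {v β βs w} → mate M β v ≡ v × mate M β x ≢ x →
            Fan M (mate M β x) βs w → Fan M v (β ∷ βs) w

    fan-++ : ∀ {M v w z βs γs} → Fan M v βs w → Fan M w γs z → Fan M v (βs ++ γs) z
    fan-++ []      g = g
    fan-++ (s ∷ f) g = s ∷ fan-++ f g

    fan-split : ∀ {M} βs {v z γs} → Fan M v (βs ++ γs) z →
                ∃ λ w → Fan M v βs w × Fan M w γs z
    fan-split []       f       = _ , [] , f
    fan-split (_ ∷ βs) (s ∷ f) with fan-split βs f
    ... | w , g , h = w , s ∷ g , h

    fan-cong : ∀ {M M′ v w βs} → All (λ β → ∀ u → mate M′ β u ≡ mate M β u) βs →
               Fan M v βs w → Fan M′ v βs w
    fan-cong []         []                     = []
    fan-cong (eq ∷ eqs) ((free , present) ∷ f) =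
      (trans (eq _) free , present ∘ trans (sym (eq _))) ∷
      subst (λ u → Fan _ u _ _) (sym (eq _)) (fan-cong eqs f)

    fan-present : ∀ {M v w βs} → Fan M v βs w → All (λ β → mate M β x ≢ x) βs
    fan-present []            = []
    fan-present ((_ , p) ∷ f) = p ∷ fan-present f

    fan-last : ∀ {M v w β βs} → Fan M v (β ∷ βs) w → ∃ λ γ → γ ∈ β ∷ βs × w ≡ mate M γ x
    fan-last (_ ∷ [])        = _ , here refl , refl
    fan-last (_ ∷ f@(_ ∷ _)) = let γ , γ∈ , eq = fan-last f in γ , there γ∈ , eq

    fan-end≢x : ∀ {M v w βs} → v ≢ x → Fan M v βs w → w ≢ x
    fan-end≢x v≢x []            = v≢x
    fan-end≢x v≢x ((_ , p) ∷ f) = fan-end≢x p f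

    -- Each step moves the colour of the next spoke to the uncoloured one, so the next spoke becomes
    -- the uncoloured one. The last spoke takes `d`, which is missing at both its ends, so no edge
    -- ends up without a colour. Since the fan colours are distinct, a step leaves the rest of the
    -- fan intact.
    rotate : ∀ (M : PartialColouring k) {v w βs d} → Adj G x v → ¬ Coloured M x v →
             Fan M v βs w → Unique βs → mate M d w ≡ w → mate M d x ≡ x →
             Extension M x v
    rotate M {v} {d = d} xv uncoloured [] _ dw dx = put , put-colours , kept
      where
      open Put M x v d xv uncoloured dw
      kept : Extends M put
      kept a≢b ab with put-keeps a≢b ab
      ... | inj₁ ab′                 = ab′
      ... | inj₂ (inj₁ (refl , refl)) = ⊥-elim (a≢b (sym dx))
      ... | inj₂ (inj₂ (refl , refl)) = ⊥-elim (a≢b dx)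
    rotate M {v} {d = d} xv uncoloured (_∷_ {β = β} (free , present) f) (fresh ∷ uniq) dw dx
      with rotate put {d = d} (adjacent M β x present) (put-uncolours present) f′ uniq dw′ dx′
      where
      open Put M x v β xv uncoloured free
      f′ = fan-cong (All.map (λ β≢γ u → put-other u (β≢γ ∘ sym)) fresh) f
      d≢β : d ≢ β
      d≢β refl = present dx
      dw′ = trans (put-other _ d≢β) dw
      dx′ = trans (put-other _ d≢β) dx
    ... | M′ , xw , ext = M′ , ext x≢v put-colours , kept
      where
      open Put M x v β xv uncoloured free
      kept : Extends M M′
      kept a≢b ab with put-keeps a≢b ab
      ... | inj₁ ab′                  = ext a≢b ab′
      ... | inj₂ (inj₁ (refl , refl)) = xw
      ... | inj₂ (inj₂ (refl , refl)) = coloured-sym M′ xw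

    module _ (M : PartialColouring k) {v : Fin n} (xv : Adj G x v)
             (uncoloured : ¬ Coloured M x v) where

      -- An end beyond `v` is joined to `x` by a colour of its own stretch, and distinct colours
      -- lead to distinct neighbours; no colour joins `v` to `x`.
      fan-ends-distinct : ∀ {βs γ γs w z} → Unique (βs ++ γ ∷ γs) →
                          Fan M v βs w → Fan M w (γ ∷ γs) z → w ≢ z
      fan-ends-distinct uniq [] g w≡z =
        let _ , _ , z≡ = fan-last g in uncoloured (_ , sym (trans w≡z z≡))
      fan-ends-distinct {βs} uniq f@(_ ∷ _) g w≡z =
        let _ , β∈ , w≡ = fan-last f
            _ , γ∈ , z≡ = fan-last g
        in All.lookup (fan-present f) β∈
             (disjoint M (unique-++-≢ βs uniq β∈ γ∈) (trans (sym w≡) (trans w≡z z≡)))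

      -- The Misra–Gries step: both w and z miss d, so at most one of them lies
      -- on the cd-chain of x.  After the swap x misses d, and the edge at x
      -- that had colour d has colour c.
      resolve : ∀ βs {γs w z c d} → Unique (βs ++ d ∷ γs) →
                Fan M v βs w → Fan M w (d ∷ γs) z →
                mate M d z ≡ z → mate M c x ≡ x → Extension M x v
      resolve βs {γs} {w} {z} {c} {d} uniq f g@((dw , dx) ∷ g′) dz cx =
        extension-trans {M = M} {M′ = swap} (λ _ → swap-coloured) (extension (orbit? w))
        where
        open Kempe M c d x cx

        c≢fan : All (c ≢_) (βs ++ d ∷ γs)
        c≢fan = All.map (λ p → λ { refl → p cx }) (fan-present (fan-++ f g))

        -- The swap affects only `c`, which is absent from the fan because `x` misses it, and `d`,
        -- which occurs there once.
        unchanged : ∀ {βs} → All (c ≢_) βs → All (d ≢_) βs →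
                    All (λ β → ∀ u → mate swap β u ≡ mate M β u) βs
        unchanged []       []       = []
        unchanged (p ∷ ps) (q ∷ qs) = (λ u → swap-other u (p ∘ sym) (q ∘ sym)) ∷ unchanged ps qs

        d≢βs : All (d ≢_) βs
        d≢βs = All.tabulate λ β∈ eq → unique-++-≢ βs uniq β∈ (here refl) (sym eq)

        d≢γs : ∀ xs → Unique (xs ++ d ∷ γs) → All (d ≢_) γs
        d≢γs []       (fresh ∷ _) = fresh
        d≢γs (_ ∷ xs) (_ ∷ uniq)  = d≢γs xs uniq

        f′ : Fan swap v βs w
        f′ = fan-cong (unchanged (All.++⁻ˡ βs c≢fan) d≢βs) f

        dx′ : mate swap d x ≡ x
        dx′ = trans (swap-inside d start∈orbit)
          (trans (cong (λ e → mate M e x) (transpose-second c d)) cx)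

        cu′ : ∀ {u} → Orbit u → mate swap c u ≡ mate M d u
        cu′ u∈ = trans (swap-inside c u∈) (cong (λ e → mate M e _) (transpose-first c d))

        extension : Dec (Orbit w) → Extension swap x v
        -- The swap leaves `d` missing at `w`, so the part of the fan before `d` is rotated.
        extension (no w∉) = rotate swap {d = d} xv (uncoloured ∘ swap-coloured⁻) f′
          (unique-prefix βs uniq) (trans (swap-outside d w∉) dw) dx′
        -- Now `w` misses `c`, so the whole fan survives with `c` in place of `d`, and its end `z`,
        -- off the chain, still misses `d`.
        extension (yes w∈) = rotate swap {d = d} xv (uncoloured ∘ swap-coloured⁻)
          (fan-++ f′ ((trans (cu′ w∈) dw , dx ∘ trans (sym (cu′ start∈orbit))) ∷ g″))
          (unique-replace βs c≢fan uniq) (trans (swap-outside d z∉) dz) dx′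
          where
          g″ : Fan swap (mate swap c x) γs z
          g″ = subst (λ u → Fan swap u γs z) (sym (cu′ start∈orbit))
            (fan-cong (unchanged (All.tail (All.++⁻ʳ βs c≢fan)) (d≢γs βs uniq)) g′)
          v≢x : v ≢ x
          v≢x = Adj-irrefl xv ∘ sym
          w≢x : w ≢ x
          w≢x = fan-end≢x v≢x f
          z∉ : ¬ Orbit z
          z∉ z∈ = fan-ends-distinct uniq f g
            (one-end w≢x (fan-end≢x w≢x g) dw dz w∈ z∈)

      module _ (missing : ∀ u → ∃ λ c → mate M c u ≡ u) where

        -- A colour `d` missing at the end of the fan is missing at `x` (rotate), new to the fan
        -- (lengthen it), or repeated (`resolve`). Distinct colours limit the length to `k`, so the
        -- fuel cannot run out.
        grow : ∀ fuel {βs w} → k < fuel + List.length βs → Unique βs → Fan M v βs w →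
               Extension M x v
        grow zero        short uniq f = ⊥-elim (ℕ.<⇒≱ short (unique-length uniq))
        grow (suc fuel) {βs} {w} short uniq f with missing w
        ... | d , dw with mate M d x Fin.≟ x
        ...   | yes dx = rotate M {d = d} xv uncoloured f uniq dw dx
        ...   | no dx with Any.any? (d Fin.≟_) βs
        ...     | no d∉ = grow fuel
          (subst (k <_) (trans (sym (ℕ.+-suc fuel _))
            (cong (fuel +_) (trans (ℕ.+-comm 1 _) (sym (List.length-++ βs))))) short)
          (Unique.++⁺ uniq ([] ∷ []) λ { (d∈ , here refl) → d∉ d∈ })
          (fan-++ f ((dw , dx) ∷ []))
        ...     | yes d∈ with ∈-∃++ d∈
        ...       | pre , suf , refl with fan-split pre f
        ...         | _ , f₁ , f₂ = resolve pre uniq f₁ f₂ dw (proj₂ (missing x))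

        extend : Extension M x v
        extend = grow (suc k) (ℕ.m≤m+n (suc k) 0) [] []

  -- Colouring the edges one by one

  neighbours : Fin n → List (Fin n)
  neighbours u = filter (λ v → T? (adj u v)) (allFin n)

  degree≤Δ : ∀ u → degree G u ≤ Δ G
  degree≤Δ u = All.lookup (xs≤max 0 (List.map (degree G) (allFin n)))
                          (∈-map⁺ (degree G) (∈-allFin u))

  -- Otherwise the mates of `u` would be more than `Δ G` distinct neighbours.
  missing-colour : (M : PartialColouring (suc (Δ G))) → ∀ u → ∃ λ c → mate M c u ≡ u
  missing-colour M u = decidable-stable (any? λ c → mate M c u Fin.≟ u) λ none →
    let mate∈ : ∀ c → mate M c u ∈ neighbours u
        mate∈ c = ∈-filter⁺ (λ v → T? (adj u v)) (∈-allFin (mate M c u))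
                            (adjacent M c u (none ∘ (c ,_)))
        mate-injective : ∀ {c d} → mate M c u ≡ mate M d u → c ≡ d
        mate-injective {c} {d} eq = decidable-stable (c Fin.≟ d) λ c≢d →
          none (c , disjoint M c≢d eq)
    in ℕ.<⇒≱ (Fin.injective⇒≤ {f = index ∘ mate∈} λ {c} {d} eq → mate-injective
               (trans (lookup-index (mate∈ c))
                 (trans (cong (List.lookup (neighbours u)) eq) (sym (lookup-index (mate∈ d))))))
             (degree≤Δ u)

  colour-edges : ∀ (ps : List (Fin n × Fin n)) → ∃ λ (M : PartialColouring (suc (Δ G))) →
                 All (λ (u , v) → Adj G u v → Coloured M u v) ps
  colour-edges []             = empty , []
  colour-edges ((u , v) ∷ ps) with colour-edges ps
  ... | M , done with T? (adj u v)
  ...   | no ¬uv = M , (⊥-elim ∘ ¬uv) ∷ done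
  ...   | yes uv with any? (λ c → mate M c u Fin.≟ v)
  -- This happens, for instance, when the other orientation of the edge came earlier.
  ...     | yes coloured = M , (λ _ → coloured) ∷ done
  ...     | no uncoloured with extend u M uv uncoloured (missing-colour M)
  ...       | M′ , uv′ , M⊆M′ =
    M′ , (λ _ → uv′) ∷ All.map (λ ab e → M⊆M′ (Adj-irrefl e) (ab e)) done

  total⇒proper : ∀ {k} (M : PartialColouring k) → (∀ u v → Adj G u v → Coloured M u v) →
                 ProperlyColourable G k
  total⇒proper M total =
    record { colour = λ u v e → proj₁ (total u v e) ; colour-sym = same } , proper
    where
    same : ∀ u v e e′ → proj₁ (total u v e) ≡ proj₁ (total v u e′)
    same u v e e′ with total u v e | total v u e′
    ... | c , refl | d , eq = decidable-stable (c Fin.≟ d) λ c≢d →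
      Adj-irrefl e (sym (disjoint M c≢d (trans (sym (involutive M d _)) (cong (mate M d) eq))))
    proper : ∀ u v w e e′ → v ≢ w → proj₁ (total u v e) ≢ proj₁ (total u w e′)
    proper u v w e e′ v≢w eq with total u v e | total u w e′
    proper u v w e e′ v≢w refl | c , p | _ , q = v≢w (trans (sym p) q)

  vizing : χ′ G ≤ suc (Δ G)
  vizing = proj₂ (proj₂ (χ′-least G)) (suc (Δ G)) (total⇒proper M λ u v →
    All.lookup done (∈-cartesianProduct⁺ (∈-allFin u) (∈-allFin v)))
    where
    M = proj₁ (colour-edges (cartesianProduct (allFin n) (allFin n)))
    done = proj₂ (colour-edges (cartesianProduct (allFin n) (allFin n)))

-- The bounds on prc

module _ {n : ℕ} (G : Graph n) where
  open Graph G
  open EdgeColouring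

  neighbours-unique : ∀ u → Unique (neighbours G u)
  neighbours-unique u = Unique.filter⁺ (λ v → T? (adj u v)) (Unique.allFin⁺ n)

  proper⇒degree≤ : ∀ {k} → ProperlyColourable G k → ∀ u → degree G u ≤ k
  proper⇒degree≤ (c , proper) u = Fin.injective⇒≤ {f = λ i → colour c u (neighbour i) (edge i)}
    λ {i} {j} eq → lookup-injective (neighbours-unique u)
      (decidable-stable (neighbour i Fin.≟ neighbour j) λ i≢j →
        proper u _ _ (edge i) (edge j) i≢j eq)
    where
    neighbour = List.lookup (neighbours G u)
    edge : ∀ i → Adj G u (neighbour i)
    edge i = proj₂ (∈-filter⁻ (λ v → T? (adj u v)) {xs = allFin n} (∈-lookup i))

  proper⇒Δ≤ : ∀ {k} → ProperlyColourable G k → Δ G ≤ k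
  proper⇒Δ≤ c = max≤v⁺ z≤n (All.map⁺ (All.universal (proper⇒degree≤ c) (allFin n)))

  length-colours : ∀ {k} (c : EdgeColouring G k) {u v} (w : Walk G u v) →
                   List.length (colours G c w) ≡ length G w
  length-colours c ε       = refl
  length-colours c (_ ◅ w) = cong suc (length-colours c w)

  -- Paths within an injectively coloured set of edges

  SameEdge : (u v u′ v′ : Fin n) → Set
  SameEdge u v u′ v′ = (u ≡ u′ × v ≡ v′) ⊎ (u ≡ v′ × v ≡ u′)

  module _ (E : Fin n → Fin n → Set) where

    EdgesIn : ∀ {u v} → Walk G u v → Set
    EdgesIn ε                 = ⊤
    EdgesIn (_◅_ {u} {v} _ w) = E u v × EdgesIn w

    PathIn : Fin n → Fin n → Set
    PathIn u v = ∃ λ (w : Walk G u v) → IsPath G w × EdgesIn w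

    suffix-from : ∀ {u v x} (w : Walk G u v) → x ∈ vertices G w → IsPath G w → EdgesIn w →
                  PathIn x v
    suffix-from ε       (here refl) path       edges       = ε , path , edges
    suffix-from (e ◅ w) (here refl) path       edges       = e ◅ w , path , edges
    suffix-from (e ◅ w) (there x∈)  (_ ∷ path) (_ , edges) = suffix-from w x∈ path edges

    -- If the path built so far already visits `u`, its part from `u` on is kept.
    erase-loops : ∀ {u v} → Star (λ u v → Adj G u v × E u v) u v → PathIn u v
    erase-loops ε = ε , [] ∷ [] , tt
    erase-loops {u} ((e , e∈E) ◅ s) with erase-loops s
    ... | w , path , edges with Any.any? (u Fin.≟_) (vertices G w)
    ...   | yes u∈ = suffix-from w u∈ path edges
    ...   | no  u∉ = e ◅ w , ¬Any⇒All¬ _ u∉ ∷ path , e∈E , edges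

    module _ {k} (c : EdgeColouring G k)
             (c-injective : ∀ {u v u′ v′} e e′ → E u v → E u′ v′ →
                            colour c u v e ≡ colour c u′ v′ e′ → SameEdge u v u′ v′) where

      start∈vertices : ∀ {u v} (w : Walk G u v) → u ∈ vertices G w
      start∈vertices ε       = here refl
      start∈vertices (_ ◅ _) = here refl

      -- A later edge of the same colour would be the same undirected edge and end in `u`, where the
      -- path does not return.
      fresh-colour : ∀ {u v} (e : Adj G u v) → E u v → ∀ {x y} (w : Walk G x y) → EdgesIn w →
                     All (u ≢_) (vertices G w) → All (colour c u v e ≢_) (colours G c w)
      fresh-colour e e∈E ε       _             _         = []
      fresh-colour e e∈E (f ◅ w) (f∈E , edges) (u≢x ∷ u∉) =
        (λ eq → [ u≢x ∘ proj₁ , All.lookup u∉ (start∈vertices w) ∘ proj₁ ]′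
                  (c-injective e f e∈E f∈E eq)) ∷
        fresh-colour e e∈E w edges u∉

      path⇒rainbow : ∀ {u v} (w : Walk G u v) → IsPath G w → EdgesIn w →
                     Unique (colours G c w)
      path⇒rainbow ε       _           _             = []
      path⇒rainbow (e ◅ w) (u∉ ∷ path) (e∈E , edges) =
        fresh-colour e e∈E w edges u∉ ∷ path⇒rainbow w path edges

  -- The diameter bound

  module _ (conn : Connected G) where

    dist≤ : ∀ {k} (c : EdgeColouring G k) → RainbowConnecting G c → ∀ u v → dist G conn u v ≤ k
    dist≤ c rainbow u v with u Fin.≟ v
    -- `RainbowConnecting` is silent about equal ends; the empty walk gives distance 0.
    ... | yes refl = ℕ.≤-trans (proj₂ (proj₂ (dist-least G conn u u)) 0 (ε , refl , [] ∷ [])) z≤n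
    ... | no u≢v with rainbow u v u≢v
    ...   | w , path , distinct = ℕ.≤-trans
      (proj₂ (proj₂ (dist-least G conn u v)) _ (w , refl , path))
      (subst (_≤ _) (length-colours c w) (unique-length distinct))

    diam≤ : ∀ {k} (c : EdgeColouring G k) → RainbowConnecting G c → diam G conn ≤ k
    diam≤ c rainbow = max≤v⁺ z≤n (All.tabulate λ d∈ →
      let u , v , _ , _ , eq = ∈-cartesianProductWith⁻ (dist G conn) (allFin n) (allFin n) d∈
      in subst (_≤ _) (sym eq) (dist≤ c rainbow u v))

    -- A spanning tree containing the star at `r`

    module _ (r : Fin n) where

      far? : Decidable (λ v → v ≢ r × ¬ Adj G r v)
      far? v = ¬? (v Fin.≟ r) ×-dec ¬? (T? (adj r v))

      far : List (Fin n)
      far = filter far? (allFin n)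

      far-spec : ∀ {v} → v ∈ far → v ≢ r × ¬ Adj G r v
      far-spec = proj₂ ∘ ∈-filter⁻ far? {xs = allFin n}

      -- `r`, its neighbours and `far` together form a list without repetitions.
      degree+far<n : degree G r + List.length far < n
      degree+far<n = subst (λ l → suc l ≤ n) (List.length-++ (neighbours G r)) (unique-length
        (All.++⁺ (All.tabulate λ v∈ → Adj-irrefl G (adjacent v∈))
                 (All.tabulate λ v∈ → proj₁ (far-spec v∈) ∘ sym) ∷
         Unique.++⁺ (neighbours-unique r) (Unique.filter⁺ far? (Unique.allFin⁺ n))
           λ (v∈ , v∈far) → proj₂ (far-spec v∈far) (adjacent v∈)))
        where
        adjacent : ∀ {v} → v ∈ neighbours G r → Adj G r v
        adjacent = proj₂ ∘ ∈-filter⁻ (λ v → T? (adj r v)) {xs = allFin n}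

      -- The second vertex of a shortest path to `r`.
      closer : ∀ v → v ≢ r → ∃ λ p → Adj G v p × dist G conn p r < dist G conn v r
      closer v v≢r with dist-least G conn v r
      ... | _ , (ε , _ , _) , _ = ⊥-elim (v≢r refl)
      ... | _ , (e ◅ w , refl , _ ∷ path) , _ =
        _ , e , s≤s (proj₂ (proj₂ (dist-least G conn _ r)) _ (w , refl , path))

      parent : Fin n → Fin n
      parent v with v Fin.≟ r
      -- A default value: `Child` only uses parents of vertices in `far`.
      ... | yes _  = r
      ... | no v≢r = proj₁ (closer v v≢r)

      parent-closer : ∀ {v} → v ≢ r →
                      Adj G v (parent v) × dist G conn (parent v) r < dist G conn v r
      parent-closer {v} v≢r with v Fin.≟ r
      ... | yes v≡r  = ⊥-elim (v≢r v≡r)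
      ... | no v≢r = proj₂ (closer v v≢r)

      Child : Fin n → Fin n → Set
      Child u v = u ∈ far × parent u ≡ v

      child? : ∀ u v → Dec (Child u v)
      child? u v = Any.any? (u Fin.≟_) far ×-dec (parent u Fin.≟ v)

      -- The distance to `r` drops from child to parent. Hence the child is determined by the
      -- undirected edge, and its position in `far` can serve as the colour.
      child-asym : ∀ {u v} → Child u v → ¬ Child v u
      child-asym {u} (u∈ , refl) (v∈ , eq) = ℕ.<-asym
        (proj₂ (parent-closer (proj₁ (far-spec u∈))))
        (subst (λ w → dist G conn w r < dist G conn (parent u) r) eq
          (proj₂ (parent-closer (proj₁ (far-spec v∈)))))

      -- The edges of a spanning tree containing the star at r.
      TreeEdge : Fin n → Fin n → Set
      TreeEdge u v = (Child u v ⊎ Child v u) ⊎ (u ≡ r ⊎ v ≡ r)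

      -- Both ends climb through parents to a neighbour of `r` and then to `r`; joining the two
      -- walks and erasing loops gives the path.
      tree-path : ∀ u v → PathIn TreeEdge u v
      tree-path u v = erase-loops TreeEdge (ascend u ◅◅ reverse step-sym (ascend v))
        where
        Step : Fin n → Fin n → Set
        Step u v = Adj G u v × TreeEdge u v

        step-sym : ∀ {u v} → Step u v → Step v u
        step-sym (e , inj₁ (inj₁ p)) = Adj-sym G e , inj₁ (inj₂ p)
        step-sym (e , inj₁ (inj₂ p)) = Adj-sym G e , inj₁ (inj₁ p)
        step-sym (e , inj₂ (inj₁ p)) = Adj-sym G e , inj₂ (inj₂ p)
        step-sym (e , inj₂ (inj₂ p)) = Adj-sym G e , inj₂ (inj₁ p)

        ascend′ : ∀ v → Acc _<_ (dist G conn v r) → Star Step v r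
        ascend′ v (acc rec) with v Fin.≟ r | T? (adj r v)
        ... | yes refl | _      = ε
        ... | no _     | yes rv = (Adj-sym G rv , inj₂ (inj₂ refl)) ◅ ε
        ... | no v≢r   | no ¬rv =
          (proj₁ (parent-closer v≢r) ,
           inj₁ (inj₁ (∈-filter⁺ far? (∈-allFin v) (v≢r , ¬rv) , refl))) ◅
          ascend′ (parent v) (rec (proj₂ (parent-closer v≢r)))

        ascend : ∀ v → Star Step v r
        ascend v = ascend′ v (<-wellFounded _)

      -- Recolouring the tree edges outside the star

      module _ {k} (c : EdgeColouring G k) (proper : Proper G c) where

        recolour : ∀ u v → Adj G u v → Fin k ⊎ Fin (List.length far)
        recolour u v e with child? u v | child? v u
        ... | yes (u∈ , _) | _            = inj₂ (index u∈)
        ... | no _         | yes (v∈ , _) = inj₂ (index v∈)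
        ... | no _         | no _         = inj₁ (colour c u v e)

        recolour-sym : ∀ u v e e′ → recolour u v e ≡ recolour v u e′
        recolour-sym u v e e′ with child? u v | child? v u
        ... | yes uv | yes vu = ⊥-elim (child-asym uv vu)
        ... | yes _  | no _   = refl
        ... | no _   | yes _  = refl
        ... | no _   | no _   = cong inj₁ (colour-sym c u v e e′)

        recolour-old : ∀ {u v} e {a} → recolour u v e ≡ inj₁ a →
                       colour c u v e ≡ a × ¬ (Child u v ⊎ Child v u)
        recolour-old {u} {v} e eq with child? u v | child? v u
        recolour-old e ()   | yes _  | _
        recolour-old e ()   | no _   | yes _
        recolour-old e refl | no ¬uv | no ¬vu = refl , [ ¬uv , ¬vu ]′

        recolour-new : ∀ {u v} e {i} → recolour u v e ≡ inj₂ i →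
                       SameEdge u v (List.lookup far i) (parent (List.lookup far i))
        recolour-new {u} {v} e eq with child? u v | child? v u
        recolour-new e refl | yes (u∈ , refl) | _ =
          inj₁ (lookup-index u∈ , cong parent (lookup-index u∈))
        recolour-new e refl | no _ | yes (v∈ , refl) =
          inj₂ (cong parent (lookup-index v∈) , lookup-index v∈)

        new-same : ∀ {u v u′ v′} e e′ {i} → recolour u v e ≡ inj₂ i → recolour u′ v′ e′ ≡ inj₂ i →
                   SameEdge u v u′ v′
        new-same e e′ eq eq′ with recolour-new e eq | recolour-new e′ eq′
        ... | inj₁ (refl , refl) | inj₁ (refl , refl) = inj₁ (refl , refl)
        ... | inj₁ (refl , refl) | inj₂ (refl , refl) = inj₂ (refl , refl)
        ... | inj₂ (refl , refl) | inj₁ (refl , refl) = inj₂ (refl , refl)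
        ... | inj₂ (refl , refl) | inj₂ (refl , refl) = inj₁ (refl , refl)

        recoloured : EdgeColouring G (k + List.length far)
        recoloured = record
          { colour     = λ u v e → join k _ (recolour u v e)
          ; colour-sym = λ u v e e′ → cong (join k _) (recolour-sym u v e e′) }

        join-injective : ∀ {l} x y → join k l x ≡ join k l y → x ≡ y
        join-injective {l} x y eq = trans (sym (Fin.splitAt-join k l x))
          (trans (cong (splitAt k) eq) (Fin.splitAt-join k l y))

        -- Edges with old colours are separated by `proper`, and a new colour belongs to a single
        -- edge.
        recoloured-proper : Proper G recoloured
        recoloured-proper u v w e e′ v≢w eq = clash (recolour u v e) refl
          where
          eq′ : recolour u w e′ ≡ recolour u v e
          eq′ = sym (join-injective _ _ eq)
          clash : ∀ t → recolour u v e ≡ t → ⊥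
          clash (inj₁ a) p = proper u v w e e′ v≢w
            (trans (proj₁ (recolour-old e p)) (sym (proj₁ (recolour-old e′ (trans eq′ p)))))
          clash (inj₂ i) p with new-same e e′ p (trans eq′ p)
          ... | inj₁ (_ , v≡w)    = v≢w v≡w
          ... | inj₂ (refl , v≡u) = Adj-irrefl G e (sym v≡u)

        -- Edges of the star meet in `r`, so `proper` separates them; the four cases are their
        -- orientations.
        star-same : ∀ {u v u′ v′} e e′ → u ≡ r ⊎ v ≡ r → u′ ≡ r ⊎ v′ ≡ r →
                    colour c u v e ≡ colour c u′ v′ e′ → SameEdge u v u′ v′
        star-same e e′ (inj₁ refl) (inj₁ refl) eq = inj₁ (refl ,
          decidable-stable (_ Fin.≟ _) λ v≢w → proper _ _ _ e e′ v≢w eq)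
        star-same e e′ (inj₁ refl) (inj₂ refl) eq = inj₂ (refl ,
          decidable-stable (_ Fin.≟ _) λ v≢w → proper _ _ _ e (Adj-sym G e′) v≢w
            (trans eq (colour-sym c _ _ e′ _)))
        star-same e e′ (inj₂ refl) (inj₁ refl) eq = inj₂ (
          (decidable-stable (_ Fin.≟ _) λ v≢w → proper _ _ _ (Adj-sym G e) e′ v≢w
            (trans (sym (colour-sym c _ _ e _)) eq)) , refl)
        star-same e e′ (inj₂ refl) (inj₂ refl) eq = inj₁ (
          (decidable-stable (_ Fin.≟ _) λ v≢w → proper _ _ _ (Adj-sym G e) (Adj-sym G e′) v≢w
            (trans (sym (colour-sym c _ _ e _)) (trans eq (colour-sym c _ _ e′ _)))) , refl)

        old-star : ∀ {u v} e {a} → TreeEdge u v → recolour u v e ≡ inj₁ a → u ≡ r ⊎ v ≡ r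
        old-star e (inj₁ child) eq = ⊥-elim (proj₂ (recolour-old e eq) child)
        old-star e (inj₂ star)  eq = star

        -- Tree edges that keep an old colour lie in the star; each new colour occurs on one edge
        -- only.
        recoloured-injective : ∀ {u v u′ v′} e e′ → TreeEdge u v → TreeEdge u′ v′ →
          colour recoloured u v e ≡ colour recoloured u′ v′ e′ → SameEdge u v u′ v′
        recoloured-injective {u} {v} {u′} {v′} e e′ t t′ eq = same (recolour u v e) refl
          where
          eq′ : recolour u′ v′ e′ ≡ recolour u v e
          eq′ = sym (join-injective _ _ eq)
          same : ∀ t → recolour u v e ≡ t → SameEdge u v u′ v′
          same (inj₁ a) p = star-same e e′ (old-star e t p) (old-star e′ t′ (trans eq′ p))
            (trans (proj₁ (recolour-old e p)) (sym (proj₁ (recolour-old e′ (trans eq′ p)))))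
          same (inj₂ i) p = new-same e e′ p (trans eq′ p)

        recoloured-connecting : RainbowConnecting G recoloured
        recoloured-connecting u v _ with tree-path u v
        ... | w , path , edges =
          w , path , path⇒rainbow TreeEdge recoloured recoloured-injective w path edges

    prc≤χ′+far : ∀ r → prc G conn ≤ χ′ G + List.length (far r)
    prc≤χ′+far r = proj₂ (proj₂ (prc-least G conn)) _
      (recoloured r c proper , recoloured-proper r c proper , recoloured-connecting r c proper)
      where
      c = proj₁ (proj₁ (proj₂ (χ′-least G)))
      proper = proj₂ (proj₁ (proj₂ (χ′-least G)))

  -- If all degrees were below `Δ G`, so would be the start value 0 of `max`, because of the vertex
  -- `u`, and then `Δ G` itself.
  Δ-attained : Fin n → ∃ λ r → Δ G ≤ degree G r
  Δ-attained u = decidable-stable (any? λ r → Δ G ℕ.≤? degree G r) λ none →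
    ℕ.<-irrefl refl (max<v⁺ (ℕ.≤-<-trans z≤n (ℕ.≰⇒> (none ∘ (u ,_))))
      (All.map⁺ (All.universal (λ r → ℕ.≰⇒> (none ∘ (r ,_))) (allFin n))))

  Δ<n : Fin n → Δ G < n
  Δ<n u with Δ-attained u
  ... | r , Δ≤ = ℕ.≤-<-trans Δ≤ (unique-length
    (All.tabulate (λ v∈ → Adj-irrefl G (proj₂ (∈-filter⁻ (λ v → T? (adj r v)) {xs = allFin n} v∈)))
      ∷ neighbours-unique r))

  far≤ : (conn : Connected G) → ∀ {r} → Δ G ≤ degree G r → List.length (far conn r) ≤ n ∸ 1 ∸ Δ G
  far≤ conn {r} Δ≤ = ℕ.m+n≤o⇒m≤o∸n (List.length (far conn r))
    (ℕ.≤-trans (ℕ.+-monoʳ-≤ (List.length (far conn r)) Δ≤)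
      (subst (_≤ n ∸ 1) (ℕ.+-comm (degree G r) _) (ℕ.<⇒≤pred (degree+far<n conn r))))

theorem2p2 : ∀ (n : ℕ) (G : Graph n) (conn : Connected G) → 2 ≤ n →
    (Δ G ⊔ diam G conn ≤ prc G conn) ×
    (prc G conn ≤ χ′ G + (n ∸ 1 ∸ Δ G)) ×
    (Class2 G → χ′ G + (n ∸ 1 ∸ Δ G) ≡ n) ×
    (Class1 G → χ′ G + (n ∸ 1 ∸ Δ G) ≡ n ∸ 1)
-- From here on the order is `suc n`, so the `n ∸ 1` of the statement becomes `n`, and `zero` is a
-- vertex.
theorem2p2 (suc n) G conn _ = lower , upper , class2 , class1
  where
  Δ≤n : Δ G ≤ n
  Δ≤n = s≤s⁻¹ (Δ<n G zero)

  lower : Δ G ⊔ diam G conn ≤ prc G conn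
  lower = let c , proper , rainbow = proj₁ (proj₂ (prc-least G conn)) in
    ℕ.⊔-lub (proper⇒Δ≤ G (c , proper)) (diam≤ G conn c rainbow)

  upper : prc G conn ≤ χ′ G + (n ∸ Δ G)
  upper = let r , Δ≤ = Δ-attained G zero in
    ℕ.≤-trans (prc≤χ′+far G conn r) (ℕ.+-monoʳ-≤ (χ′ G) (far≤ G conn Δ≤))

  class2 : Class2 G → χ′ G + (n ∸ Δ G) ≡ suc n
  class2 χ′≢Δ = trans (cong (_+ (n ∸ Δ G)) χ′≡1+Δ) (cong suc (ℕ.m+[n∸m]≡n Δ≤n))
    where
    χ′≡1+Δ : χ′ G ≡ suc (Δ G)
    χ′≡1+Δ = ℕ.≤-antisym (vizing G)
      (ℕ.≤∧≢⇒< (proper⇒Δ≤ G (proj₁ (proj₂ (χ′-least G)))) (χ′≢Δ ∘ sym))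

  class1 : Class1 G → χ′ G + (n ∸ Δ G) ≡ n
  class1 χ′≡Δ = trans (cong (_+ (n ∸ Δ G)) χ′≡Δ) (ℕ.m+[n∸m]≡n Δ≤n)
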